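{- Let $n\geq 1$ and $d\geq 2$. Then the classes of frames $\mathcal{C}^{d}_{det}$ and $\mathcal{GC}^{d}_{det}$ are both $n$-unitary.
   Context: Formulas. Let $x_1,x_2,\ldots$ be an enumeration without repetitions of a countably infinite set of variables. For $n\geq 1$, $\mathrm{FOR}_n$ is the set of modal formulas ($n$-formulas) given by $\varphi,\psi ::= x_i \mid \bot \mid \neg\varphi \mid (\varphi\vee\psi) \mid \square\varphi$ with $1\leq i\leq n$; other connectives ($\top,\wedge,\rightarrow,\leftrightarrow$) are the usual abbreviations and $\lozenge\varphi$ is $\neg\square\neg\varphi$. Frames and validity. A frame is a pair $(W,R)$ with $W$ a nonempty set and $R$ a binary relation on $W$. An $n$-model based on $(W,R)$ adds a valuation $V$ assigning a subset $V(x_i)\subseteq W$ to each $x_i$, $1\leq i\leq n$; satisfaction is the usual Kripke semantics ($s\models\square\varphi$ iff $t\models\varphi$ for all $t$ with $sRt$). For a class $\mathcal{C}$ of frames, $\mathcal{C}\models\varphi$ means that $\varphi$ is satisfied at every point of every model based on a frame in $\mathcal{C}$. Classes of frames. A frame is deterministic if $sRt$ and $sRu$ imply $t=u$. A frame is $d$-bounded if for all $s_0,\ldots,s_d\in W$ there is $i\in\mathbb{N}$ with $i<d$ such that not $s_iRs_{i+1}$. $\mathcal{C}^{d}_{det}$ is the class of all deterministic $d$-bounded frames. $\mathcal{GC}^{d}_{det}$ is the class of all frames $(W,R)$ with $W=\{0,1,\ldots,d'\}$ and $R=\{(s,t)\in W\times W: t-s=1\}$ for some $d'\in\mathbb{N}$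 with $d'<d$. Unification. An $n$-substitution is a pair $(k,\sigma)$ where $k\geq 1$ and $\sigma:\mathrm{FOR}_n\to\mathrm{FOR}_k$ satisfies $\sigma(\bot)=\bot$, $\sigma(\neg\varphi)=\neg\sigma(\varphi)$, $\sigma(\varphi\vee\psi)=\sigma(\varphi)\vee\sigma(\psi)$, $\sigma(\square\varphi)=\square\sigma(\varphi)$. For $n$-substitutions, $(k,\sigma)\preccurlyeq^n_{\mathcal{C}}(l,\tau)$ iff there is a $k$-substitution $(m,\upsilon)$ such that $\mathcal{C}\models\upsilon(\sigma(x_i))\leftrightarrow\tau(x_i)$ for all $i\in\{1,\ldots,n\}$. A $(\mathcal{C},n)$-unifier of $\varphi\in\mathrm{FOR}_n$ is an $n$-substitution $(k,\sigma)$ with $\mathcal{C}\models\sigma(\varphi)$; $\varphi$ is $(\mathcal{C},n)$-unifiable if it has a $(\mathcal{C},n)$-unifier. A set $\Sigma$ of $(\mathcal{C},n)$-unifiers of $\varphi$ is $(\mathcal{C},n)$-complete if for every $(\mathcal{C},n)$-unifier $(k,\sigma)$ of $\varphi$ there is $(l,\tau)\in\Sigma$ with $(l,\tau)\preccurlyeq^n_{\mathcal{C}}(k,\sigma)$; it is minimal if no proper subset of it is $(\mathcal{C},n)$-complete. The class $\mathcal{C}$ is $n$-unitary if every $(\mathcal{C},n)$-unifiable $n$-formula possesses a minimal $(\mathcal{C},n)$-complete set of $(\mathcal{C},n)$-unifiers with cardinality $1$. -}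

module Defs where

open import Data.Empty using (⊥)
open import Data.Fin using (Fin; toℕ; inject₁; inject≤) renaming (zero to fzero; suc to fsuc)
open import Data.Nat using (ℕ; suc; _≤_; _<_; _+_; _⊔_)
open import Data.Nat.Properties using (m≤m⊔n; m≤n⊔m)
open import Data.Product using (Σ-syntax; ∃; ∃-syntax; _×_)
open import Data.Sum using (_⊎_)
open import Level using (0ℓ) renaming (suc to lsuc)
open import Relation.Binary.Core using (Rel)
open import Relation.Binary.Definitions using (_Respects_)
open import Relation.Binary.PropositionalEquality using (_≡_; subst)
open import Relation.Nullary using (¬_)
open import Relation.Unary using (Pred; _∈_; _⊆_; _⊂_)

infix  9 ¬ᶠ_ □_
infixl 7 _∧ᶠ_
infixl 6 _∨ᶠ_
infixr 5 _→ᶠ_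
infix  4 _↔ᶠ_
infix  3 _⊨_

-- `var i` is the variable x_{i+1}, so that `Fin n` indexes x_1, …, x_n.
data FOR (n : ℕ) : Set where
  var  : Fin n → FOR n
  ⊥ᶠ   : FOR n
  ¬ᶠ_  : FOR n → FOR n
  _∨ᶠ_ : FOR n → FOR n → FOR n
  □_   : FOR n → FOR n

_∧ᶠ_ _→ᶠ_ _↔ᶠ_ : ∀ {n} → FOR n → FOR n → FOR n
φ ∧ᶠ ψ = ¬ᶠ (¬ᶠ φ ∨ᶠ ¬ᶠ ψ)
φ →ᶠ ψ = ¬ᶠ φ ∨ᶠ ψ
φ ↔ᶠ ψ = (φ →ᶠ ψ) ∧ᶠ (ψ →ᶠ φ)

-- The inclusion of FOR m in FOR n for m ≤ n: the variable x_i is sent to x_i.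
embed : ∀ {m n} → m ≤ n → FOR m → FOR n
embed m≤n (var i)  = var (inject≤ i m≤n)
embed m≤n ⊥ᶠ       = ⊥ᶠ
embed m≤n (¬ᶠ φ)   = ¬ᶠ embed m≤n φ
embed m≤n (φ ∨ᶠ ψ) = embed m≤n φ ∨ᶠ embed m≤n ψ
embed m≤n (□ φ)    = □ embed m≤n φ

record Frame : Set₁ where
  field
    W        : Set
    R        : Rel W 0ℓ
    nonempty : W

FrameClass : Set₁
FrameClass = Pred Frame 0ℓ

Valuation : ℕ → Frame → Set₁
Valuation n F = Fin n → Pred (Frame.W F) 0ℓ

-- Satisfaction is classical although the metatheory is constructive: atoms and
-- disjunctions are read under a double negation (Gödel–Gentzen), which makes
-- `Sat F V s φ` stable for every φ. Under excluded middle the double negations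
-- can be erased and these are the usual Kripke clauses.
Sat : ∀ {n} (F : Frame) → Valuation n F → Frame.W F → FOR n → Set
Sat F V s (var i)  = ¬ ¬ (s ∈ V i)
Sat F V s ⊥ᶠ       = ⊥
Sat F V s (¬ᶠ φ)   = ¬ Sat F V s φ
Sat F V s (φ ∨ᶠ ψ) = ¬ ¬ (Sat F V s φ ⊎ Sat F V s ψ)
Sat F V s (□ φ)    = ∀ t → Frame.R F s t → Sat F V t φ

_⊨_ : ∀ {n} → FrameClass → FOR n → Set₁
_⊨_ {n} C φ = (F : Frame) → F ∈ C → (V : Valuation n F) (s : Frame.W F) → Sat F V s φ

Deterministic : FrameClass
Deterministic F = ∀ s t u → R s t → R s u → t ≡ u
  where open Frame F

Bounded : ℕ → FrameClass
Bounded d F = (s : Fin (suc d) → W) → ∃[ i ] ¬ R (s (inject₁ i)) (s (fsuc i))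
  where open Frame F

𝒞-det : ℕ → FrameClass
𝒞-det d F = Deterministic F × Bounded d F

chain : ℕ → Frame
chain d′ = record
  { W        = Fin (suc d′)
  ; R        = λ s t → toℕ t ≡ 1 + toℕ s
  ; nonempty = fzero
  }

data 𝒢𝒞-det (d : ℕ) : FrameClass where
  isChain : ∀ {d′} → d′ < d → chain d′ ∈ 𝒢𝒞-det d

record Substitution (n : ℕ) : Set where
  field
    k   : ℕ
    k≥1 : 1 ≤ k
    σ   : FOR n → FOR k
    σ-⊥ : σ ⊥ᶠ ≡ ⊥ᶠ
    σ-¬ : ∀ φ → σ (¬ᶠ φ) ≡ ¬ᶠ σ φ
    σ-∨ : ∀ φ ψ → σ (φ ∨ᶠ ψ) ≡ σ φ ∨ᶠ σ ψ
    σ-□ : ∀ φ → σ (□ φ) ≡ □ σ φ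

-- Equality of pairs (k , σ), with functions compared extensionally.
_≈_ : ∀ {n} → Substitution n → Substitution n → Set
S ≈ T = Σ[ k≡l ∈ S.k ≡ T.k ] (∀ φ → subst FOR k≡l (S.σ φ) ≡ T.σ φ)
  where
  module S = Substitution S
  module T = Substitution T

-- υ need not have the codomain of τ: the two formulas are compared in
-- FOR (m ⊔ l), which contains both FOR m and FOR l.
_≼[_]_ : ∀ {n} → Substitution n → FrameClass → Substitution n → Set₁
_≼[_]_ {n} S C T = Σ[ U ∈ Substitution S.k ] let module U = Substitution U in
  ∀ (i : Fin n) →
    C ⊨ embed (m≤m⊔n U.k T.k) (U.σ (S.σ (var i))) ↔ᶠ embed (m≤n⊔m U.k T.k) (T.σ (var i))
  where
  module S = Substitution S
  module T = Substitution T

Unifier : ∀ {n} → FrameClass → FOR n → Pred (Substitution n) (lsuc 0ℓ)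
Unifier C φ S = C ⊨ Substitution.σ S φ

Unifiable : ∀ {n} → FrameClass → FOR n → Set₁
Unifiable C φ = ∃ (Unifier C φ)

-- A set of substitutions is a predicate that cannot separate equal ones.
record SubstitutionSet (n : ℕ) : Set₂ where
  field
    members  : Pred (Substitution n) (lsuc 0ℓ)
    respects : members Respects _≈_

open SubstitutionSet public using (members)

record Complete {n} (C : FrameClass) (φ : FOR n) (X : SubstitutionSet n) : Set₁ where
  field
    unifiers : members X ⊆ Unifier C φ
    covers   : ∀ S → S ∈ Unifier C φ → ∃[ T ] (T ∈ members X × T ≼[ C ] S)

record MinimalComplete {n} (C : FrameClass) (φ : FOR n) (X : SubstitutionSet n) : Set₂ where
  field
    complete : Complete C φ X
    minimal  : ∀ Y → members Y ⊂ members X → ¬ Complete C φ Y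

CardinalityOne : ∀ {n} → SubstitutionSet n → Set₁
CardinalityOne X = ∃[ S ] (S ∈ members X × (∀ T → T ∈ members X → T ≈ S))

Unitary : ℕ → FrameClass → Set₂
Unitary n C = (φ : FOR n) → Unifiable C φ →
  Σ[ X ∈ SubstitutionSet n ] (MinimalComplete C φ X × CardinalityOne X)

{-# OPTIONS --safe #-}

-- Up to equivalence, a formula of FOR n is a set of nonempty words of length
-- ≤ d over the alphabet of truth assignments to x_1, …, x_n: a point of a frame
-- is described by the assignments met along the only path leaving it. A
-- substitution is then a length-preserving map on words that commutes with
-- taking suffixes. If φ has a unifier, consider the set E of the words that
-- are suffixes of words of length d all of whose nonempty suffixes satisfy φ.
-- Every unifier maps into E, since every word is a suffix of one of length d.
-- Replacing letters from right to left, only when the word would leave E,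
-- retracts all words onto E; this retraction is definable by formulas, hence
-- it is a unifier γ, and σ ∘ γ is equivalent to σ for every unifier σ.

module Submission where

open import Data.Bool using (Bool; true; false; not; _∨_; T; if_then_else_)
open import Data.Bool.Properties using (not-involutive; ∨-identityʳ) renaming (_≟_ to _≟ᵇ_)
open import Data.Empty using (⊥)
open import Data.Fin using (Fin; toℕ; inject₁; fromℕ) renaming (zero to fzero; suc to fsuc)
open import Data.Fin.Properties using (toℕ-injective; toℕ<n; ¬∀⟶∃¬; sequence)
open import Data.Fin.Subset using (Subset)
open import Data.Fin.Subset.Properties using (anySubset?)
open import Data.List using (List; []; _∷_; length; drop)
import Data.List as List
open import Data.List.Properties using (∷-injective)
open import Data.Nat using (ℕ; zero; suc; _+_; _∸_; _≤_; _<_; z≤n; s≤s)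
import Data.Nat as ℕ
open import Data.Nat.Properties
  using (≤-trans; ≤-irrelevant; <⇒≤; <⇒≱; m∸n+n≡m; +-∸-assoc; +-identityʳ; +-suc;
         m≤m+n; m≤m⊔n; m≤n⊔m; ≤-reflexive)
open import Data.Product using (Σ-syntax; ∃-syntax; _×_; _,_; proj₁; proj₂)
open import Data.Unit using (⊤; tt)
open import Data.Vec using ([]; _∷_; lookup; tabulate; replicate)
open import Data.Vec.Properties using (lookup∘tabulate; tabulate∘lookup; tabulate-cong)
open import Effect.Monad using (RawMonad)
open import Function using (_∘_; id)
open import Level using (Lift; lift; lower)
open import Relation.Binary.PropositionalEquality
open import Relation.Nullary
  using (Dec; yes; no; does; proof; ¬_; contradiction; Reflects; ofʸ; ofⁿ; invert; _×-dec_; ¬¬-map)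
open import Relation.Nullary.Decidable using (¬¬-excluded-middle)
open import Relation.Nullary.Negation using (¬¬-Monad; negated-stable; Stable)
open import Relation.Nullary.Reflects using (T-reflects; ¬-reflects; _⊎-reflects_)
open import Relation.Unary using (_∈_; _⊆_)

open import Defs

private
  variable
    n k d : ℕ

-- Words of truth assignments and the evaluation of formulas

Letter : ℕ → Set
Letter = Subset

Word : ℕ → Set
Word n = List (Letter n)

-- The first letter is a separate argument because satisfaction at the empty
-- word would be meaningless.
eval : Letter n → Word n → FOR n → Bool
eval a w       (var i)  = lookup a i
eval a w       ⊥ᶠ       = false
eval a w       (¬ᶠ φ)   = not (eval a w φ)
eval a w       (φ ∨ᶠ ψ) = eval a w φ ∨ eval a w ψ
eval a []      (□ φ)    = true
eval a (b ∷ w) (□ φ)    = eval b w φ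

-- The word tested is `a ∷ w`, so the bound allows at most `d` letters. This finite criterion stands
-- in for validity in both classes of frames.
Holds : ℕ → FOR n → Set
Holds d φ = ∀ a w → length w < d → eval a w φ ≡ true

eval-↔ : ∀ (a : Letter n) w φ ψ → eval a w φ ≡ eval a w ψ → eval a w (φ ↔ᶠ ψ) ≡ true
eval-↔ a w φ ψ eq rewrite eq with eval a w ψ
... | true  = refl
... | false = refl

-- Words and points of frames

-- A relation rather than a function, since neither membership in a valuation nor the existence of a
-- successor is decidable. A word must end at a point without successors.
data Describes (F : Frame) (V : Valuation n F) : Frame.W F → Letter n → Word n → Set where
  last : ∀ {s a} → (∀ i → Reflects (s ∈ V i) (lookup a i)) →
         (∀ t → ¬ Frame.R F s t) → Describes F V s a []
  next : ∀ {s t a b w} → (∀ i → Reflects (s ∈ V i) (lookup a i)) →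
         Frame.R F s t → Describes F V t b w → Describes F V s a (b ∷ w)

-- Describing words are obtained only under a double negation; stability lets them be used to prove
-- satisfaction.
Sat-stable : ∀ (F : Frame) (V : Valuation n F) s φ → Stable (Sat F V s φ)
Sat-stable F V s (var i)  = negated-stable
Sat-stable F V s ⊥ᶠ       = λ ¬¬⊥ → ¬¬⊥ id
Sat-stable F V s (¬ᶠ φ)   = negated-stable
Sat-stable F V s (φ ∨ᶠ ψ) = negated-stable
Sat-stable F V s (□ φ)    = λ ¬¬□ t r → Sat-stable F V t φ (¬¬-map (λ f → f t r) ¬¬□)

¬¬-reflects : ∀ {A : Set} {b} → Reflects A b → Reflects (¬ ¬ A) b
¬¬-reflects r = subst (Reflects _) (not-involutive _) (¬-reflects (¬-reflects r))

Sat-reflects : ∀ {F} {V : Valuation n F} → F ∈ Deterministic → ∀ {s a w} →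
               Describes F V s a w → ∀ φ → Reflects (Sat F V s φ) (eval a w φ)
Sat-reflects det (last l _)   (var i)  = ¬¬-reflects (l i)
Sat-reflects det (next l _ _) (var i)  = ¬¬-reflects (l i)
Sat-reflects det D            ⊥ᶠ       = ofⁿ id
Sat-reflects det D            (¬ᶠ φ)   = ¬-reflects (Sat-reflects det D φ)
Sat-reflects det D            (φ ∨ᶠ ψ) =
  ¬¬-reflects (Sat-reflects det D φ ⊎-reflects Sat-reflects det D ψ)
Sat-reflects det (last _ stop) (□ φ)   = ofʸ λ t r → contradiction r (stop t)
Sat-reflects {F = F} {V} det (next {b = b} {w} _ r D) (□ φ)
  with eval b w φ | Sat-reflects det D φ
-- Determinism identifies every successor `u` with the point described by the tail.
... | true  | ofʸ p  = ofʸ λ u r′ → subst (λ x → Sat F V x φ) (det _ _ _ r r′) p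
... | false | ofⁿ ¬p = ofⁿ λ f → ¬p (f _ r)

-- Inductive form of the absence of paths of `d` steps from `s`; it bounds the recursion that reads
-- off a describing word.
Depth : (F : Frame) → ℕ → Frame.W F → Set
Depth F zero    s = ⊥
Depth F (suc d) s = ∀ t → Frame.R F s t → Depth F d t

module _ (F : Frame) where
  open Frame F

  Path : ℕ → W → Set
  Path d s = Σ[ p ∈ (Fin (suc d) → W) ] (p fzero ≡ s × (∀ i → R (p (inject₁ i)) (p (fsuc i))))

  path-cons : ∀ {s t} → R s t → Path d t → Path (suc d) s
  path-cons {s = s} r (p , refl , step) = q , refl , q-step
    where
    q : Fin _ → W
    q fzero    = s
    q (fsuc i) = p i
    q-step : ∀ i → R (q (inject₁ i)) (q (fsuc i))
    q-step fzero    = r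
    q-step (fsuc i) = step i

  pathless⇒depth : ∀ d s → ¬ Path d s → Depth F d s
  pathless⇒depth zero    s ¬p     = ¬p ((λ _ → s) , refl , λ ())
  pathless⇒depth (suc d) s ¬p t r = pathless⇒depth d t (¬p ∘ path-cons r)

  bounded⇒depth : F ∈ Bounded d → ∀ s → Depth F d s
  bounded⇒depth bd s = pathless⇒depth _ s λ (p , _ , step) → proj₂ (bd p) (step (proj₁ (bd p)))

  -- There are finitely many variables, so the instances of excluded middle, one for each, combine
  -- under a single double negation.
  ¬¬-letter : (V : Valuation n F) (s : W) →
              ¬ ¬ (Σ[ a ∈ Letter n ] (∀ i → Reflects (s ∈ V i) (lookup a i)))
  ¬¬-letter V s = ¬¬-map
    (λ dec → tabulate (does ∘ dec) ,
             λ i → subst (Reflects _) (sym (lookup∘tabulate (does ∘ dec) i)) (proof (dec i)))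
    (sequence (RawMonad.rawApplicative ¬¬-Monad) (λ i → ¬¬-excluded-middle))

  ¬¬-described : (V : Valuation n F) → ∀ d s → Depth F d s →
                 ¬ ¬ (∃[ a ] ∃[ w ] (length w < d × Describes F V s a w))
  ¬¬-described V (suc d) s dep ¬D =
    ¬¬-letter V s λ (a , l) →
    ¬¬-excluded-middle {A = ∃[ t ] R s t} λ where
      (no stop)     → ¬D (a , [] , s≤s z≤n , last l λ t r → stop (t , r))
      (yes (t , r)) → ¬¬-described V d t (dep t r) λ (b , w , w<d , D) →
        ¬D (a , b ∷ w , s≤s w<d , next l r D)

Holds⇒𝒞-det⊨ : ∀ (φ : FOR n) → Holds d φ → 𝒞-det d ⊨ φ
Holds⇒𝒞-det⊨ φ holds F (det , bd) V s = Sat-stable F V s φ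
  (¬¬-map (λ (a , w , w<d , D) →
             invert (subst (Reflects _) (holds a w w<d) (Sat-reflects det D φ)))
          (¬¬-described F V _ s (bounded⇒depth F bd s)))

-- Chains as bounded deterministic frames that realise words

chain-deterministic : chain k ∈ Deterministic
chain-deterministic s t u r r′ = toℕ-injective (trans r (sym r′))

chain-climb : ∀ d (p : Fin (suc d) → Fin k) → (∀ i → toℕ (p (fsuc i)) ≡ 1 + toℕ (p (inject₁ i))) →
              toℕ (p (fromℕ d)) ≡ d + toℕ (p fzero)
chain-climb zero    p step = refl
chain-climb (suc d) p step = begin
  toℕ (p (fromℕ (suc d)))   ≡⟨ chain-climb d (p ∘ fsuc) (step ∘ fsuc) ⟩
  d + toℕ (p (fsuc fzero))  ≡⟨ cong (d +_) (step fzero) ⟩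
  d + suc (toℕ (p fzero))   ≡⟨ +-suc d _ ⟩
  suc d + toℕ (p fzero)     ∎
  where open ≡-Reasoning

chain-bounded : k < d → chain k ∈ Bounded d
-- Edges of a chain are decidable, so a missing one can be searched for. Were none missing, the last
-- point would have index at least `d`, but indices are at most `k`.
chain-bounded {k} {d} k<d p = ¬∀⟶∃¬ d _ (λ i → toℕ (p (fsuc i)) ℕ.≟ 1 + toℕ (p (inject₁ i))) λ step →
  <⇒≱ (toℕ<n (p (fromℕ d)))
      (≤-trans k<d (≤-trans (m≤m+n d _) (≤-reflexive (sym (chain-climb d p step)))))

𝒢𝒞-det⊆𝒞-det : 𝒢𝒞-det d ⊆ 𝒞-det d
𝒢𝒞-det⊆𝒞-det (isChain k<d) = chain-deterministic , chain-bounded k<d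

drop-toℕ≢[] : ∀ {A : Set} (xs : List A) (i : Fin (length xs)) → drop (toℕ i) xs ≢ []
drop-toℕ≢[] (x ∷ xs) fzero    ()
drop-toℕ≢[] (x ∷ xs) (fsuc i) = drop-toℕ≢[] xs i

drop≡∷ : ∀ {A : Set} m (xs : List A) {y ys} → drop m xs ≡ y ∷ ys →
         Σ[ i ∈ Fin (length xs) ] (toℕ i ≡ m × List.lookup xs i ≡ y × drop (suc m) xs ≡ ys)
drop≡∷ zero    (x ∷ xs) refl = fzero , refl , refl , refl
drop≡∷ (suc m) (x ∷ xs) eq   with drop≡∷ m xs eq
... | i , toℕi , at , rest = fsuc i , cong suc toℕi , at , rest

module _ (a : Letter n) (w : Word n) where

  wordValuation : Valuation n (chain (length w))
  wordValuation i s = T (lookup (List.lookup (a ∷ w) s) i)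

  -- The letters after position `s` form a separate argument `v`, tied by an equation, so that the
  -- recursion can run on `v`.
  chain-describes : ∀ s v → drop (suc (toℕ s)) (a ∷ w) ≡ v →
                    Describes (chain (length w)) wordValuation s (List.lookup (a ∷ w) s) v
  chain-describes s []      eq = last (λ i → T-reflects _) λ t r →
    drop-toℕ≢[] (a ∷ w) t (trans (cong (λ m → drop m (a ∷ w)) r) eq)
  chain-describes s (b ∷ v) eq with drop≡∷ (suc (toℕ s)) (a ∷ w) eq
  ... | t , r , refl , rest =
    next (λ i → T-reflects _) r
      (chain-describes t v (trans (cong (λ m → drop (suc m) (a ∷ w)) r) rest))

𝒢𝒞-det⊨⇒Holds : ∀ (φ : FOR n) → 𝒢𝒞-det d ⊨ φ → Holds d φ
𝒢𝒞-det⊨⇒Holds φ valid a w w<d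
  with eval a w φ | Sat-reflects chain-deterministic (chain-describes a w fzero w refl) φ
... | true  | _      = refl
... | false | ofⁿ ¬p = contradiction (valid _ (isChain w<d) (wordValuation a w) fzero) ¬p

-- Substitutions as maps on words

module _ (S : Substitution n) where
  open Substitution S using (σ; σ-⊥; σ-¬; σ-∨; σ-□) renaming (k to l)

  pullLetter : Letter l → Word l → Letter n
  pullLetter a w = tabulate λ i → eval a w (σ (var i))

  pull : Word l → Word n
  pull []      = []
  pull (a ∷ w) = pullLetter a w ∷ pull w

  -- Substitution lemma. The box clause goes through because `pull` preserves length and commutes
  -- with tails.
  eval-σ : ∀ φ a w → eval a w (σ φ) ≡ eval (pullLetter a w) (pull w) φ
  eval-σ (var i)  a w       = sym (lookup∘tabulate _ i)
  eval-σ ⊥ᶠ       a w       rewrite σ-⊥ = refl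
  eval-σ (¬ᶠ φ)   a w       rewrite σ-¬ φ = cong not (eval-σ φ a w)
  eval-σ (φ ∨ᶠ ψ) a w       rewrite σ-∨ φ ψ = cong₂ _∨_ (eval-σ φ a w) (eval-σ ψ a w)
  eval-σ (□ φ)    a []      rewrite σ-□ φ = refl
  eval-σ (□ φ)    a (b ∷ w) rewrite σ-□ φ = eval-σ φ b w

  length-pull : ∀ w → length (pull w) ≡ length w
  length-pull []      = refl
  length-pull (a ∷ w) = cong suc (length-pull w)

  Holds-σ : ∀ φ → Holds d φ → Holds d (σ φ)
  Holds-σ φ holds a w w<d = trans (eval-σ φ a w)
    (holds _ (pull w) (subst (_< _) (sym (length-pull w)) w<d))

embedding : ∀ {m} → 1 ≤ m → m ≤ n → Substitution m
embedding {n} 1≤m m≤n = record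
  { k = n ; k≥1 = ≤-trans 1≤m m≤n ; σ = embed m≤n
  ; σ-⊥ = refl ; σ-¬ = λ _ → refl ; σ-∨ = λ _ _ → refl ; σ-□ = λ _ → refl }

apply : (Fin n → FOR k) → FOR n → FOR k
apply f (var i)  = f i
apply f ⊥ᶠ       = ⊥ᶠ
apply f (¬ᶠ φ)   = ¬ᶠ apply f φ
apply f (φ ∨ᶠ ψ) = apply f φ ∨ᶠ apply f ψ
apply f (□ φ)    = □ apply f φ

substitution : 1 ≤ k → (Fin n → FOR k) → Substitution n
substitution {k} 1≤k f = record
  { k = k ; k≥1 = 1≤k ; σ = apply f
  ; σ-⊥ = refl ; σ-¬ = λ _ → refl ; σ-∨ = λ _ _ → refl ; σ-□ = λ _ → refl }

≈-refl : {S : Substitution n} → S ≈ S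
≈-refl = refl , λ _ → refl

≈-sym : {S T : Substitution n} → S ≈ T → T ≈ S
≈-sym (k≡l , eq) = sym k≡l , λ φ → trans (cong (subst FOR (sym k≡l)) (sym (eq φ))) (subst-sym-subst k≡l)

≈-trans : {S T U : Substitution n} → S ≈ T → T ≈ U → S ≈ U
≈-trans (k≡l , eq) (l≡m , eq′) = trans k≡l l≡m , λ φ →
  trans (sym (subst-subst k≡l)) (trans (cong (subst FOR l≡m) (eq φ)) (eq′ φ))

-- Definability

constant : Bool → FOR n
constant true  = ¬ᶠ ⊥ᶠ
constant false = ⊥ᶠ

eval-constant : ∀ (a : Letter n) w b → eval a w (constant b) ≡ b
eval-constant a w true  = refl
eval-constant a w false = refl

ite : FOR n → FOR n → FOR n → FOR n
ite χ φ ψ = (χ ∧ᶠ φ) ∨ᶠ (¬ᶠ χ ∧ᶠ ψ)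

eval-ite : ∀ (a : Letter n) w χ φ ψ →
           eval a w (ite χ φ ψ) ≡ (if eval a w χ then eval a w φ else eval a w ψ)
eval-ite a w χ φ ψ with eval a w χ
... | true  = trans (∨-identityʳ _) (not-involutive _)
... | false = not-involutive _

-- Shannon expansion: a nested case distinction on the formulas `χ`, with one branch per vector of
-- truth values.
byValues : (Fin k → FOR n) → (Letter k → FOR n) → FOR n
byValues {zero}  χ f = f []
byValues {suc k} χ f = ite (χ fzero) (byValues (χ ∘ fsuc) (f ∘ (true ∷_)))
                                     (byValues (χ ∘ fsuc) (f ∘ (false ∷_)))

eval-byValues : ∀ (a : Letter n) w (χ : Fin k → FOR n) f →
                eval a w (byValues χ f) ≡ eval a w (f (tabulate (eval a w ∘ χ)))
eval-byValues {k = zero}  a w χ f = refl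
eval-byValues {k = suc k} a w χ f =
  trans (eval-ite a w (χ fzero) (byValues (χ ∘ fsuc) (f ∘ (true ∷_)))
                         (byValues (χ ∘ fsuc) (f ∘ (false ∷_)))) branch
  where
  branch : (if eval a w (χ fzero) then eval a w (byValues (χ ∘ fsuc) (f ∘ (true ∷_)))
                                  else eval a w (byValues (χ ∘ fsuc) (f ∘ (false ∷_))))
           ≡ eval a w (f (tabulate (eval a w ∘ χ)))
  branch with eval a w (χ fzero)
  ... | true  = eval-byValues a w (χ ∘ fsuc) (f ∘ (true ∷_))
  ... | false = eval-byValues a w (χ ∘ fsuc) (f ∘ (false ∷_))

byLetter : (Letter n → FOR n) → FOR n
byLetter = byValues var

eval-byLetter : ∀ (a : Letter n) w f → eval a w (byLetter f) ≡ eval a w (f a)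
eval-byLetter a w f = trans (eval-byValues a w var f) (cong (eval a w ∘ f) (tabulate∘lookup a))

-- Expressive completeness: any Boolean property of words with at most `h + 1` letters is definable,
-- by cases on the first letter and recursion on the tail.
defining : ℕ → (Letter n → Word n → Bool) → FOR n
defining zero    P = byLetter λ a → constant (P a [])
defining (suc h) P = byLetter λ a →
  -- `□ ⊥ᶠ` is true exactly when no letter follows the first.
  ite (□ ⊥ᶠ) (constant (P a [])) (□ defining h λ b w → P a (b ∷ w))

eval-defining : ∀ h (P : Letter n → Word n → Bool) a w → length w ≤ h →
                eval a w (defining h P) ≡ P a w
eval-defining zero    P a []      _         = trans (eval-byLetter a [] _) (eval-constant a [] _)
eval-defining (suc h) P a []      _         =
  trans (eval-byLetter a [] _)
    (trans (eval-ite a [] (□ ⊥ᶠ) (constant (P a [])) (□ defining h (λ b w → P a (b ∷ w))))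
      (eval-constant a [] _))
eval-defining (suc h) P a (b ∷ w) (s≤s w≤h) =
  trans (eval-byLetter a (b ∷ w) _)
    (trans (eval-ite a (b ∷ w) (□ ⊥ᶠ) (constant (P a [])) (□ defining h (λ b w → P a (b ∷ w))))
      (eval-defining h _ b w w≤h))

-- The retraction onto extendable words

module _ (φ : FOR n) where

  Everywhere : Word n → Set
  Everywhere []      = ⊤
  Everywhere (a ∷ w) = eval a w φ ≡ true × Everywhere w

  Everywhere? : ∀ w → Dec (Everywhere w)
  Everywhere? []      = yes tt
  Everywhere? (a ∷ w) = (eval a w φ ≟ᵇ true) ×-dec Everywhere? w

  -- Letters are added in front. With `m = d ∸ length w` this is membership in the set E of the
  -- opening comment.
  Extendable : ℕ → Word n → Set
  Extendable zero    w = Everywhere w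
  Extendable (suc m) w = ∃[ a ] Extendable m (a ∷ w)

  Extendable? : ∀ m w → Dec (Extendable m w)
  Extendable? zero    w = Everywhere? w
  -- The alphabet is finite, so the added letter can be found by search.
  Extendable? (suc m) w = anySubset? λ a → Extendable? m (a ∷ w)

  Extendable⇒Everywhere : ∀ m {w} → Extendable m w → Everywhere w
  Extendable⇒Everywhere zero    e       = e
  Extendable⇒Everywhere (suc m) (a , e) = proj₂ (Extendable⇒Everywhere m e)

  -- The last case is junk: it does not occur when w is extendable by suc m letters.
  adjust : ℕ → Letter n → Word n → Letter n
  adjust m a w with Extendable? m (a ∷ w) | Extendable? (suc m) w
  ... | yes _ | _           = a
  ... | no _  | yes (b , _) = b
  ... | no _  | no _        = a

  adjust-extendable : ∀ m a w → Extendable (suc m) w → Extendable m (adjust m a w ∷ w)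
  adjust-extendable m a w e with Extendable? m (a ∷ w) | Extendable? (suc m) w
  ... | yes e′ | _            = e′
  ... | no _   | yes (b , e′) = e′
  ... | no _   | no ¬e        = contradiction e ¬e

  adjust-fixes : ∀ m a w → Extendable m (a ∷ w) → adjust m a w ≡ a
  adjust-fixes m a w e with Extendable? m (a ∷ w) | Extendable? (suc m) w
  ... | yes _ | _ = refl
  ... | no ¬e | _ = contradiction e ¬e

  pull-everywhere : ∀ (S : Substitution n) → Holds d (Substitution.σ S φ) →
                    ∀ w → length w ≤ d → Everywhere (pull S w)
  pull-everywhere S holds []      _   = tt
  pull-everywhere S holds (a ∷ w) w<d =
    trans (sym (eval-σ S φ a w)) (holds a w w<d) , pull-everywhere S holds w (<⇒≤ w<d)

  pull-extendable : ∀ (S : Substitution n) → Holds d (Substitution.σ S φ) →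
                    ∀ m w → m + length w ≤ d → Extendable m (pull S w)
  pull-extendable S holds zero    w le = pull-everywhere S holds w le
  pull-extendable S holds (suc m) w le =
    -- Any letter may be put in front of `w`; its image under `pull S` is the letter that extends
    -- `pull S w`.
    _ , pull-extendable S holds m (replicate _ false ∷ w) (≤-trans (≤-reflexive (+-suc m _)) le)

  module _ (d : ℕ) where

    retract : Word n → Word n
    retract []      = []
    -- The tail is retracted first; `d ∸ suc (length w)` letters are then still missing in front of
    -- `a ∷ w`.
    retract (a ∷ w) = adjust (d ∸ suc (length w)) a (retract w) ∷ retract w

    ∸-peel : ∀ {m} → m < d → d ∸ m ≡ suc (d ∸ suc m)
    ∸-peel = +-∸-assoc 1

    retract-extendable : Extendable d [] → ∀ w → length w ≤ d → Extendable (d ∸ length w) (retract w)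
    retract-extendable e []      _   = e
    retract-extendable e (a ∷ w) w<d = adjust-extendable (d ∸ suc (length w)) a (retract w)
      (subst (λ m → Extendable m (retract w)) (∸-peel w<d) (retract-extendable e w (<⇒≤ w<d)))

    -- A tail of a word in E is again in E, with the removed letter as witness, so from right to
    -- left no letter is ever changed.
    retract-fixes : ∀ w → length w ≤ d → Extendable (d ∸ length w) w → retract w ≡ w
    retract-fixes []      _   _ = refl
    retract-fixes (a ∷ w) w<d e
      rewrite retract-fixes w (<⇒≤ w<d) (subst (λ m → Extendable m w) (sym (∸-peel w<d)) (a , e))
      = cong (_∷ w) (adjust-fixes (d ∸ suc (length w)) a w e)

    module _ (1≤n : 1 ≤ n) where

      retraction : Substitution n
      retraction = substitution 1≤n λ i →
        defining d λ a w → lookup (adjust (d ∸ suc (length w)) a (retract w)) i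

      pullLetter-retraction : ∀ a w → length w ≤ d →
        pullLetter retraction a w ≡ adjust (d ∸ suc (length w)) a (retract w)
      pullLetter-retraction a w w≤d =
        trans (tabulate-cong λ i → eval-defining d _ a w w≤d) (tabulate∘lookup _)

      pull-retraction : ∀ w → length w ≤ d → pull retraction w ≡ retract w
      pull-retraction []      _   = refl
      pull-retraction (a ∷ w) w<d =
        cong₂ _∷_ (pullLetter-retraction a w (<⇒≤ w<d)) (pull-retraction w (<⇒≤ w<d))

      module _ (S : Substitution n) (holds : Holds d (Substitution.σ S φ)) where
        open Substitution S using (σ) renaming (k to l)

        retraction-unifies : Holds d (Substitution.σ retraction φ)
        retraction-unifies a w w<d = trans (eval-σ retraction φ a w)
          (proj₁ (subst Everywhere (sym (pull-retraction (a ∷ w) w<d))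
            (Extendable⇒Everywhere (d ∸ suc (length w)) (retract-extendable
              -- The given unifier supplies a word of length `d` satisfying `φ` at every suffix,
              -- from which the retraction starts.
              (pull-extendable S holds d [] (≤-reflexive (+-identityʳ d))) (a ∷ w) w<d))))

        -- The image of a unifier lies in E, where the retraction is the identity.
        pull-retraction-pull : ∀ w → length w ≤ d → pull retraction (pull S w) ≡ pull S w
        pull-retraction-pull w w≤d = trans
          (pull-retraction (pull S w) pw≤d)
          (retract-fixes (pull S w) pw≤d (pull-extendable S holds _ w
            (≤-reflexive (trans (cong (λ m → d ∸ m + length w) (length-pull S w)) (m∸n+n≡m w≤d)))))
          where
          pw≤d : length (pull S w) ≤ d
          pw≤d = subst (_≤ d) (sym (length-pull S w)) w≤d

        σ-retraction : ∀ i → Holds d (σ (Substitution.σ retraction (var i)) ↔ᶠ σ (var i))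
        σ-retraction i a w w<d = eval-↔ a w (σ γᵢ) (σ (var i)) (begin
          eval a w (σ γᵢ)                                  ≡⟨ eval-σ S γᵢ a w ⟩
          eval (pullLetter S a w) (pull S w) γᵢ
            ≡⟨ eval-σ retraction (var i) (pullLetter S a w) (pull S w) ⟩
          lookup (pullLetter retraction (pullLetter S a w) (pull S w)) i
            ≡⟨ cong (λ b → lookup b i) (proj₁ (∷-injective (pull-retraction-pull (a ∷ w) w<d))) ⟩
          lookup (pullLetter S a w) i                      ≡⟨ lookup∘tabulate _ i ⟩
          eval a w (σ (var i))                             ∎)
          where
          open ≡-Reasoning
          γᵢ : FOR n
          γᵢ = Substitution.σ retraction (var i)

-- From a most general unifier to unitarity

module _ {C : FrameClass} {φ : FOR n} where

  -- The set is the `≈`-class of `S`. A complete subset must cover `S`, hence has a member; that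
  -- member is `≈ S`, so the subset contains the whole class and cannot be proper.
  mostGeneral⇒unitary : ∀ {S} → S ∈ Unifier C φ → (∀ T → T ∈ Unifier C φ → S ≼[ C ] T) →
    (∀ T → T ≈ S → T ∈ Unifier C φ) →
    Σ[ X ∈ SubstitutionSet n ] (MinimalComplete C φ X × CardinalityOne X)
  mostGeneral⇒unitary {S} unifies general ≈-unifies = X , record
    { complete = record
      { unifiers = λ {T} (lift T≈S) → ≈-unifies T T≈S
      ; covers   = λ T u → S , lift (≈-refl {S = S}) , general T u
      }
    ; minimal = λ Y (Y⊆X , X⊈Y) c → X⊈Y λ {T} (lift T≈S) →
        let (U , U∈Y , _) = Complete.covers c S unifies
            U≈S = lower (Y⊆X U∈Y)
        in SubstitutionSet.respects Y
             (≈-trans {S = U} {S} {T} U≈S (≈-sym {S = T} {S} T≈S)) U∈Y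
    } , S , lift (≈-refl {S = S}) , λ T → lower
    where
    X : SubstitutionSet n
    X = record
      { members  = λ T → Lift _ (T ≈ S)
      ; respects = λ {T} {U} T≈U (lift T≈S) →
          lift (≈-trans {S = U} {T} {S} (≈-sym {S = T} {U} T≈U) T≈S)
      }

-- Validity in any class between the two coincides with `Holds d`: words describe points of the
-- larger class and are realised by chains of the smaller one.
unitary-between : 1 ≤ n → ∀ C → 𝒢𝒞-det d ⊆ C → C ⊆ 𝒞-det d → Unitary n C
unitary-between {n} {d} 1≤n C 𝒢𝒞⊆C C⊆𝒞 φ (S₀ , u₀) =
  mostGeneral⇒unitary {S = γ} γ-unifies γ-general ≈-unifies
  where
  Holds⇒⊨ : (ψ : FOR k) → Holds d ψ → C ⊨ ψ
  Holds⇒⊨ ψ holds F F∈C = Holds⇒𝒞-det⊨ ψ holds F (C⊆𝒞 F∈C)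

  ⊨⇒Holds : (ψ : FOR k) → C ⊨ ψ → Holds d ψ
  ⊨⇒Holds ψ valid = 𝒢𝒞-det⊨⇒Holds ψ λ F F∈𝒢𝒞 → valid F (𝒢𝒞⊆C F∈𝒢𝒞)

  γ : Substitution n
  γ = retraction φ d 1≤n

  γ-unifies : γ ∈ Unifier C φ
  γ-unifies = Holds⇒⊨ _ (retraction-unifies φ d 1≤n S₀ (⊨⇒Holds _ u₀))

  ≈-unifies : ∀ T → T ≈ γ → T ∈ Unifier C φ
  ≈-unifies record { σ = τ } (refl , eq) = subst (C ⊨_) (sym (eq φ)) γ-unifies

  γ-general : ∀ T → T ∈ Unifier C φ → γ ≼[ C ] T
  γ-general T u = T , λ i →
    -- With `T` itself as the witness, both sides are compared in `FOR (l ⊔ l)`, and the two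
    -- inclusions differ only in their proofs of `l ≤ l ⊔ l`.
    subst (λ le → C ⊨ embed (m≤m⊔n l l) (τ (Substitution.σ γ (var i))) ↔ᶠ embed le (τ (var i)))
      (≤-irrelevant (m≤m⊔n l l) (m≤n⊔m l l))
      (Holds⇒⊨ (embed (m≤m⊔n l l) (equiv i))
        -- The inclusion of formulas is itself a substitution, so it preserves `Holds d`.
        (Holds-σ (embedding (Substitution.k≥1 T) (m≤m⊔n l l)) (equiv i)
          (σ-retraction φ d 1≤n T (⊨⇒Holds _ u) i)))
    where
    open Substitution T using () renaming (k to l; σ to τ)
    equiv : Fin n → FOR l
    equiv i = τ (Substitution.σ γ (var i)) ↔ᶠ τ (var i)

proposition7p7 : (n d : ℕ) → 1 ≤ n → 2 ≤ d →
    Unitary n (𝒞-det d) × Unitary n (𝒢𝒞-det d)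
proposition7p7 n d 1≤n _ =
  unitary-between 1≤n (𝒞-det d) 𝒢𝒞-det⊆𝒞-det id ,
  unitary-between 1≤n (𝒢𝒞-det d) id 𝒢𝒞-det⊆𝒞-det
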